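{- Let $f:\{0,1\}^3\to\{0,1\}$ be a Boolean function of three variables. Then $ess(f)=3$ and $gap(f)=2$ (i.e. $f\in G_2^3$) if and only if, after a suitable permutation of the variables $x_1,x_2,x_3$, $f$ can be represented in one of the forms $$f=x_3^\alpha(x_1^0x_2^1\oplus x_1^1x_2^0)\oplus x_1^\beta x_2^\beta$$ or $$f=x_3^\alpha(x_1^0x_2^0\oplus x_1^1x_2^1)\oplus x_3^{\neg(\alpha)}(x_1^0x_2^1\oplus x_1^1x_2^0),$$ where $\alpha,\beta\in\{0,1\}$.
   Context: $B=\{0,1\}$ is the ring of residues modulo $2$, with addition $\oplus$ and multiplication modulo $2$; $\neg(\alpha)=1\oplus\alpha$. $P_2^n$ is the set of all functions $f:B^n\to B$, with variables $x_1,\ldots,x_n$. For $\alpha\in B$, $x^\alpha=1$ if $x=\alpha$ and $x^\alpha=0$ otherwise. A variable $x_i$ is essential in $f$ if changing the $i$-th argument alone changes the value of $f$ at some point; $Ess(f)$ is the set of essential variables and $ess(f)=|Ess(f)|$. For $i\neq j$, the identification minor $f_{i\leftarrow j}$ is the function obtained from $f$ by substituting $x_j$ for $x_i$ (regarded as a function of $x_1,\ldots,x_n$). The essential arity gap is $gap(f)=ess(f)-\max ess(f_{i\leftarrow j})$, the maximum being over all pairs of distinct essential variables $x_i,x_j$ of $f$. $G_2^3$ is the set of $f\in P_2^3$ with $ess(f)=3$ and $gap(f)=2$. -}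

module Defs where

open import Data.Bool using (Bool; true; false; not; _∧_; _xor_)
import Data.Bool as Bool
open import Data.Fin using (Fin)
import Data.Fin as Fin
open import Data.Fin.Permutation using (Permutation′; _⟨$⟩ʳ_)
open import Data.Fin.Subset using (Subset; ∣_∣)
open import Data.Fin.Subset.Properties using (_∈?_; anySubset?)
open import Data.List using (List; map; filter; cartesianProduct; allFin)
open import Data.List.Extrema.Nat using (max)
open import Data.Nat using (ℕ; _∸_)
open import Data.Product using (∃-syntax; _×_; _,_)
open import Data.Vec using (Vec; []; _∷_; lookup; tabulate; _[_]%=_; _[_]≔_)
open import Relation.Binary.PropositionalEquality using (_≡_; _≢_)
open import Relation.Nullary using (Dec)
open import Relation.Nullary.Decidable using (¬?; _×-dec_; ⌊_⌋)

private
  variable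
    n : ℕ

-- The ring B of residues modulo 2 is Bool with _xor_ as addition and _∧_ as
-- multiplication.
B : Set
B = Bool

infixr 5 _⊕_
_⊕_ : B → B → B
_⊕_ = _xor_

infix 8 _^_
_^_ : B → B → B
x ^ α = ⌊ x Bool.≟ α ⌋

-- Without function extensionality, equality of Boolean functions has to be
-- stated pointwise (_≗_).  The variable x_k is the position k - 1 in Fin n.
P₂ : ℕ → Set
P₂ n = Vec B n → B

-- The only way to change a single argument in B is to negate it.
Essential : P₂ n → Fin n → Set
Essential f i = ∃[ a ] f (a [ i ]%= not) ≢ f a

-- Subset n is by definition Vec Bool n, so anySubset? searches all of B^n.
essential? : (f : P₂ n) (i : Fin n) → Dec (Essential f i)
essential? f i = anySubset? λ a → ¬? (f (a [ i ]%= not) Bool.≟ f a)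

Ess : P₂ n → Subset n
Ess f = tabulate λ i → ⌊ essential? f i ⌋

ess : P₂ n → ℕ
ess f = ∣ Ess f ∣

infix 9 _⟨_←_⟩
_⟨_←_⟩ : P₂ n → Fin n → Fin n → P₂ n
(f ⟨ i ← j ⟩) x = f (x [ i ]≔ lookup x j)

essentialPairs : P₂ n → List (Fin n × Fin n)
essentialPairs {n} f =
  filter (λ (i , j) → i ∈? Ess f ×-dec j ∈? Ess f ×-dec ¬? (i Fin.≟ j))
         (cartesianProduct (allFin n) (allFin n))

-- The default 0 does not affect the maximum of a nonempty list of naturals; it
-- matters only when ess f < 2, where the gap is not defined mathematically.
-- The subtraction never truncates, since a minor taken on essential variables
-- has fewer essential variables than f.
gap : P₂ n → ℕ
gap f = ess f ∸ max 0 (map (λ (i , j) → ess (f ⟨ i ← j ⟩)) (essentialPairs f))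

G₂³ : P₂ 3 → Set
G₂³ f = ess f ≡ 3 × gap f ≡ 2

-- g with each variable x_i renamed to x_(π i).
permuteVars : Permutation′ n → P₂ n → P₂ n
permuteVars π g x = g (tabulate λ i → lookup x (π ⟨$⟩ʳ i))

form₁ : B → B → P₂ 3
form₁ α β (x₁ ∷ x₂ ∷ x₃ ∷ []) =
  x₃ ^ α ∧ (x₁ ^ false ∧ x₂ ^ true ⊕ x₁ ^ true ∧ x₂ ^ false) ⊕ x₁ ^ β ∧ x₂ ^ β

form₂ : B → P₂ 3
form₂ α (x₁ ∷ x₂ ∷ x₃ ∷ []) =
  x₃ ^ α ∧ (x₁ ^ false ∧ x₂ ^ false ⊕ x₁ ^ true ∧ x₂ ^ true)
  ⊕ x₃ ^ not α ∧ (x₁ ^ false ∧ x₂ ^ true ⊕ x₁ ^ true ∧ x₂ ^ false)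

{-# OPTIONS --safe #-}

-- Both implications are finite checks.  Membership in G₂³ is decidable and
-- depends only on the values of f, so the forward implication is decided over
-- the 256 value tables of functions of three variables.  There it is enough to
-- look for π among the transpositions involving x₃, as form₁ is symmetric in x₁
-- and x₂ and form₂ is symmetric in all variables.
module Submission where

open import Data.Bool using (true; false)
import Data.Bool as Bool
open import Data.Fin using (Fin; #_)
import Data.Fin as Fin
open import Data.Fin.Permutation using (Permutation′; transpose; _⟨$⟩ʳ_)
open import Data.Fin.Properties using (any?; all?)
open import Data.Fin.Subset using (∣_∣)
open import Data.Fin.Subset.Properties using (_∈?_)
open import Data.List using (filter; map; cartesianProduct; allFin)
open import Data.List.Extrema.Nat using (max)
open import Data.List.Properties using (map-cong)
open import Data.Nat using (ℕ; zero; suc; _∸_)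
import Data.Nat as ℕ
open import Data.Vec using ([]; _∷_; lookup; tabulate)
open import Data.Vec.Properties using (tabulate-cong)
open import Defs
open import Data.Product using (∃-syntax; _,_)
open import Data.Sum using (_⊎_; inj₁; inj₂)
open import Function.Base using (_∘_; _$_)
open import Function.Bundles using (_⇔_; mk⇔; Injection)
open import Function.Properties.Inverse using (↔⇒↣)
open import Relation.Binary.PropositionalEquality
  using (_≡_; _≢_; _≗_; refl; sym; trans; cong; cong₂)
open import Relation.Nullary using (Dec)
open import Relation.Nullary.Decidable
  using (¬?; _×-dec_; _⊎-dec_; _→-dec_; map′; does-⇔; isYes≗does; ⌊_⌋; from-yes)
open import Relation.Unary using (Decidable)

private
  variable
    n : ℕ
    f g : P₂ n

Essential-resp-≗ : f ≗ g → ∀ {i} → Essential f i → Essential g i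
Essential-resp-≗ f≗g {i} (a , fa′≢fa) =
  a , λ ga′≡ga → fa′≢fa (trans (f≗g _) (trans ga′≡ga (sym (f≗g a))))

isYes-⇔ : {P Q : Set} → P ⇔ Q → (p? : Dec P) (q? : Dec Q) → ⌊ p? ⌋ ≡ ⌊ q? ⌋
isYes-⇔ P⇔Q p? q? =
  trans (isYes≗does p?) (trans (does-⇔ P⇔Q p? q?) (sym (isYes≗does q?)))

-- Decisions of equivalent propositions have the same truth value. The outcome is a propositional
-- equality of subsets, so everything computed from `Ess` follows by `cong`.
Ess-cong : f ≗ g → Ess f ≡ Ess g
Ess-cong {f = f} {g = g} f≗g = tabulate-cong λ i →
  isYes-⇔ (mk⇔ (Essential-resp-≗ f≗g) (Essential-resp-≗ (sym ∘ f≗g)))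
          (essential? f i) (essential? g i)

ess-cong : f ≗ g → ess f ≡ ess g
ess-cong f≗g = cong ∣_∣ (Ess-cong f≗g)

essentialPairs-cong : f ≗ g → essentialPairs f ≡ essentialPairs g
essentialPairs-cong {n} f≗g = cong
  (λ E → filter (λ (i , j) → i ∈? E ×-dec j ∈? E ×-dec ¬? (i Fin.≟ j))
                (cartesianProduct (allFin n) (allFin n)))
  (Ess-cong f≗g)

gap-cong : f ≗ g → gap f ≡ gap g
gap-cong {f = f} {g = g} f≗g = cong₂ (λ m ms → m ∸ max 0 ms) (ess-cong f≗g)
  -- First each minor of `f` is exchanged for that of `g` along the pairs of `f`; a minor is the
  -- function itself at a modified point, hence `f≗g _`. Then the list of pairs is exchanged.
  (trans (map-cong (λ (i , j) → ess-cong {f = f ⟨ i ← j ⟩} {g = g ⟨ i ← j ⟩} (λ x → f≗g _))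
                   (essentialPairs f))
         (cong (map λ (i , j) → ess (g ⟨ i ← j ⟩)) (essentialPairs-cong f≗g)))

G₂³-resp-≗ : ∀ {f g} → f ≗ g → G₂³ f → G₂³ g
G₂³-resp-≗ f≗g (ess≡3 , gap≡2) =
  trans (sym (ess-cong f≗g)) ess≡3 , trans (sym (gap-cong f≗g)) gap≡2

G₂³? : Decidable G₂³
G₂³? f = ess f ℕ.≟ 3 ×-dec gap f ℕ.≟ 2

∀B? : {P : B → Set} → Decidable P → Dec (∀ b → P b)
∀B? P? = map′ (λ (p , q) → λ { false → p ; true → q }) (λ p → p false , p true)
              (P? false ×-dec P? true)

∃B? : {P : B → Set} → Decidable P → Dec (∃[ b ] P b)
∃B? P? = map′ (λ { (inj₁ p) → false , p ; (inj₂ p) → true , p })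
              (λ { (false , p) → inj₁ p ; (true , p) → inj₂ p })
              (P? false ⊎-dec P? true)

_≗?_ : (f g : P₂ n) → Dec (f ≗ g)
_≗?_ {zero} f g = map′ (λ { eq [] → eq }) (_$ []) (f [] Bool.≟ g [])
_≗?_ {suc n} f g = map′ (λ { eq (b ∷ x) → eq b x }) (λ eq b x → eq (b ∷ x))
                        (∀B? λ b → (f ∘ (b ∷_)) ≗? (g ∘ (b ∷_)))

-- Shannon expansion in the first variable: `g` and `h` are the cofactors.
branch : P₂ n → P₂ n → P₂ (suc n)
branch g h (false ∷ x) = g x
branch g h (true  ∷ x) = h x

branch-cong : ∀ {g g′ h h′ : P₂ n} → g ≗ g′ → h ≗ h′ → branch g h ≗ branch g′ h′
branch-cong g≗g′ h≗h′ (false ∷ x) = g≗g′ x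
branch-cong g≗g′ h≗h′ (true  ∷ x) = h≗h′ x

branch-η : (f : P₂ (suc n)) → branch (f ∘ (false ∷_)) (f ∘ (true ∷_)) ≗ f
branch-η f (false ∷ x) = refl
branch-η f (true  ∷ x) = refl

-- Induction on the number of variables: a function of none is a constant, any other a pair of
-- cofactors. Invariance under `≗` is needed because `f` is recovered from these data only
-- pointwise.
∀P₂? : {Q : P₂ n → Set} → (∀ {f g} → f ≗ g → Q f → Q g) →
       Decidable Q → Dec (∀ f → Q f)
∀P₂? {zero} resp Q? =
  map′ (λ q f → resp (λ { [] → refl }) (q (f []))) (λ q b → q (λ _ → b))
       (∀B? λ b → Q? λ _ → b)
∀P₂? {suc n} resp Q? =
  map′ (λ q f → resp (branch-η f) (q _ _)) (λ q g h → q (branch g h))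
       -- The outer search runs over `g` with the property that all `h` satisfy `Q (branch g h)`,
       -- whose invariance in `g` comes from `branch-cong`.
       (∀P₂? (λ g≗g′ q h → resp (branch-cong g≗g′ (λ _ → refl)) (q h)) λ g →
        ∀P₂? (λ h≗h′ → resp (branch-cong (λ _ → refl) h≗h′)) λ h →
        Q? (branch g h))

HasForm : Permutation′ 3 → P₂ 3 → Set
HasForm π f = (∃[ α ] ∃[ β ] f ≗ permuteVars π (form₁ α β))
            ⊎ (∃[ α ] f ≗ permuteVars π (form₂ α))

HasForm-resp-≗ : ∀ π → f ≗ g → HasForm π f → HasForm π g
HasForm-resp-≗ π f≗g (inj₁ (α , β , eq)) = inj₁ (α , β , λ x → trans (sym (f≗g x)) (eq x))
HasForm-resp-≗ π f≗g (inj₂ (α , eq))     = inj₂ (α , λ x → trans (sym (f≗g x)) (eq x))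

hasForm? : ∀ π → Decidable (HasForm π)
hasForm? π f = (∃B? λ α → ∃B? λ β → f ≗? permuteVars π (form₁ α β))
         ⊎-dec (∃B? λ α → f ≗? permuteVars π (form₂ α))

-- The variable at position `i` takes the role of x₃; `i = # 2` gives the identity.
HasTransposedForm : P₂ 3 → Set
HasTransposedForm f = ∃[ i ] HasForm (transpose (# 2) i) f

HasTransposedForm-resp-≗ : ∀ {f g} → f ≗ g → HasTransposedForm f → HasTransposedForm g
HasTransposedForm-resp-≗ f≗g (i , form) = i , HasForm-resp-≗ (transpose (# 2) i) f≗g form

hasTransposedForm? : Decidable HasTransposedForm
hasTransposedForm? f = any? λ i → hasForm? (transpose (# 2) i) f

G₂³⇒HasTransposedForm : ∀ f → G₂³ f → HasTransposedForm f
G₂³⇒HasTransposedForm = from-yes $ ∀P₂?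
  {Q = λ f → G₂³ f → HasTransposedForm f}
  -- The property is an implication, so its hypothesis is carried back from `g` to `f`.
  (λ {f} {g} f≗g form g∈G →
    HasTransposedForm-resp-≗ f≗g (form (G₂³-resp-≗ {g} {f} (sym ∘ f≗g) g∈G)))
  (λ f → G₂³? f →-dec hasTransposedForm? f)

renameVars : (Fin n → Fin n) → P₂ n → P₂ n
renameVars ρ g x = g (tabulate (lookup x ∘ ρ))

-- The renaming is given by its values since there is no function extensionality.
RenamingsInG₂³ : P₂ 3 → Set
RenamingsInG₂³ g = ∀ i j k → i ≢ j → i ≢ k → j ≢ k →
                   G₂³ (renameVars (lookup (i ∷ j ∷ k ∷ [])) g)

renamingsInG₂³? : Decidable RenamingsInG₂³
renamingsInG₂³? g = all? λ i → all? λ j → all? λ k →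
  ¬? (i Fin.≟ j) →-dec ¬? (i Fin.≟ k) →-dec ¬? (j Fin.≟ k) →-dec
  G₂³? (renameVars (lookup (i ∷ j ∷ k ∷ [])) g)

-- On three variables `tabulate` unfolds, so the renaming by the table of values of `π` is
-- definitionally `permuteVars π g`.
permuteVars∈G₂³ : ∀ g π → RenamingsInG₂³ g → G₂³ (permuteVars π g)
permuteVars∈G₂³ g π g∈ = g∈ (π ⟨$⟩ʳ # 0) (π ⟨$⟩ʳ # 1) (π ⟨$⟩ʳ # 2)
  (distinct λ ()) (distinct λ ()) (distinct λ ())
  where
  distinct : ∀ {i j} → i ≢ j → π ⟨$⟩ʳ i ≢ π ⟨$⟩ʳ j
  distinct i≢j = i≢j ∘ Injection.injective (↔⇒↣ π)

-- Here `π` is given, not chosen, so all six permutations are checked: they are the triples with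
-- distinct entries.
form₁-renamings : ∀ α β → RenamingsInG₂³ (form₁ α β)
form₁-renamings = from-yes (∀B? λ α → ∀B? λ β → renamingsInG₂³? (form₁ α β))

form₂-renamings : ∀ α → RenamingsInG₂³ (form₂ α)
form₂-renamings = from-yes (∀B? λ α → renamingsInG₂³? (form₂ α))

HasForm⇒G₂³ : ∀ f π → HasForm π f → G₂³ f
HasForm⇒G₂³ f π (inj₁ (α , β , eq)) =
  G₂³-resp-≗ {permuteVars π (form₁ α β)} {f} (sym ∘ eq)
    (permuteVars∈G₂³ (form₁ α β) π (form₁-renamings α β))
HasForm⇒G₂³ f π (inj₂ (α , eq)) =
  G₂³-resp-≗ {permuteVars π (form₂ α)} {f} (sym ∘ eq)
    (permuteVars∈G₂³ (form₂ α) π (form₂-renamings α))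

theorem3p2 : (f : P₂ 3) →
    G₂³ f ⇔
    (∃[ π ] ((∃[ α ] ∃[ β ] f ≗ permuteVars π (form₁ α β))
    ⊎ (∃[ α ] f ≗ permuteVars π (form₂ α))))
theorem3p2 f = mk⇔
  (λ f∈G → let i , form = G₂³⇒HasTransposedForm f f∈G in transpose (# 2) i , form)
  (λ (π , form) → HasForm⇒G₂³ f π form)
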